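{- Let $p$ be a prime and let $a,b$ be integers with $0\leq a,b\leq p-1$ such that $p\nmid b$ and $p\nmid a-b$. Then there are infinitely many positive integers $n$ for which every $(a,b)$-town$\pmod p$ family $\mathcal{F}\subseteq\mathscr{P}(n)$ satisfies $|\mathcal{F}|\leq n-1$.
   Context: $[n]=\{1,2,\ldots,n\}$ and $\mathscr{P}(n)$ is the power set of $[n]$; a family $\mathcal{F}\subseteq\mathscr{P}(n)$ is a set of (distinct) subsets of $[n]$. For integers $k\ge 2$ and $0\le a,b\le k-1$, a family $\mathcal{F}\subseteq\mathscr{P}(n)$ is an $(a,b)$-town$\pmod k$ if for any distinct $A,B\in\mathcal{F}$ we have $|A|\equiv a\pmod k$ and $|A\cap B|\equiv b\pmod k$; that is, every set in $\mathcal{F}$ has cardinality $\equiv a\pmod k$ and every intersection of two distinct sets of $\mathcal{F}$ has cardinality $\equiv b\pmod k$. -}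

module Defs where

open import Data.Nat.Base using (ℕ; _>_)
open import Data.Integer.Base using (ℤ; +_; _-_)
open import Data.Integer.Divisibility.Signed using (_∣_)
open import Data.Fin.Subset using (Subset; _∩_; ∣_∣)
open import Data.List.Base using (List; length)
open import Data.List.Membership.Propositional using (_∈_)
open import Data.List.Relation.Unary.Unique.Propositional using (Unique)
open import Data.Product.Base using (∃-syntax; _×_)
open import Relation.Binary.PropositionalEquality.Core using (_≢_)

infix 4 _≡_[mod_]

_≡_[mod_] : ℤ → ℤ → ℕ → Set
x ≡ y [mod k ] = + k ∣ x - y

-- A set of subsets of [n], given by a duplicate-free enumeration, so that the
-- length of the list is the cardinality of the family.
record Family (n : ℕ) : Set where
  constructor mkFamily
  field
    members : List (Subset n)
    unique  : Unique members

open Family public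

size : ∀ {n} → Family n → ℕ
size F = length (members F)

-- The condition on |A| is imposed on every member, also when the family has
-- only one.
record IsTown (k : ℕ) (a b : ℤ) {n : ℕ} (F : Family n) : Set where
  field
    sizes         : ∀ {A} → A ∈ members F → + ∣ A ∣ ≡ a [mod k ]
    intersections : ∀ {A B} → A ∈ members F → B ∈ members F → A ≢ B →
                    + ∣ A ∩ B ∣ ≡ b [mod k ]

-- Infinite sets of natural numbers are the unbounded ones.
InfinitelyMany : (ℕ → Set) → Set
InfinitelyMany P = ∀ N → ∃[ n ] (n > N × P n)

{-# OPTIONS --safe #-}

-- The n + 1 indicator vectors of [n] and of n sets A₁, …, Aₙ of a town are
-- linearly dependent in (ℤ/p)ⁿ, say d 1 + ∑ cᵢ 1_{Aᵢ} = 0 (pigeonhole on the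
-- p^{n+1} coefficient vectors). Pairing with 1_{A_k} shows (a - b) c_k to be
-- independent of k, hence all c_k equal some u, and pairing with 1 and with
-- any 1_{A_k} leaves
--   n (d + a u) = 0   and   a d + (b n + a - b) u = 0.
-- For n ≡ 0 if a ≡ 0, n ≡ b if a ≡ 1, and n ≡ 1 otherwise, these force u = 0,
-- and then d = 0, so a town on [n] has fewer than n members.

module Submission where

open import Defs
open import Data.Nat.Base as ℕ using (ℕ; _∸_)
open import Data.Nat.Primality using (Prime)
open import Data.Integer.Base using (ℤ; +_; _-_; _≤_; 0ℤ; 1ℤ)
open import Data.Integer.Divisibility.Signed using (_∣_)
open import Data.Product.Base using (_×_)
open import Relation.Nullary.Negation.Core using (¬_)

open import Data.Bool.Base using (true; false; if_then_else_)
open import Data.Fin.Base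
  using (Fin; zero; suc; toℕ; fromℕ<; inject≤; punchIn; combine; finToFun; funToFin)
open import Data.Fin.Properties
  using (toℕ<n; toℕ-injective; fromℕ<-injective; <⇒≢; punchInᵢ≢i; pigeonhole;
    inject≤-injective; funToFin-finToFin; finToFun-funToFin)
open import Data.Fin.Subset using (Subset; ⊤; ⁅_⁆; _∩_; ∣_∣)
open import Data.Fin.Subset.Properties
  using (∣⊤∣≡n; ∣⁅x⁆∣≡1; ∩-idem; ∩-identityˡ; ∩-identityʳ)
open import Data.Integer.Base as ℤ using (_+_; _*_; -_)
open import Data.Integer.Divisibility.Signed
  using (∣ᵤ⇒∣; ∣⇒∣ᵤ; _∣?_; ∣-refl; ∣m∣n⇒∣m+n; ∣m∣n⇒∣m-n; ∣m⇒∣-m; ∣n⇒∣m*n; ∣m⇒∣m*n;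
    ∣m+n∣n⇒∣m)
open import Data.Integer.DivMod using (_%ℕ_; _/ℕ_; n%ℕd<d; a≡a%ℕn+[a/ℕn]*n)
open import Data.Integer.Properties
  using (+-identityˡ; *-comm; *-identityʳ; +-*-semiring; abs-*; ∣i∣≡0⇒i≡0;
    +-injective; i-j≡0⇒i≡j; m-n≡m⊖n; ∣m⊝n∣≤m⊔n)
open import Data.Integer.Tactic.RingSolver using (solve-∀)
open import Data.List.Base using (List; lookup)
open import Data.List.Membership.Propositional.Properties using (∈-lookup)
import Data.List.Relation.Unary.All as All
open import Data.List.Relation.Unary.AllPairs using (_∷_)
open import Data.List.Relation.Unary.Unique.Propositional using (Unique)
open import Data.Nat.Divisibility as ℕ∣ using (>⇒∤)
open import Data.Nat.Primality using (¬prime[0]; prime⇒nonTrivial; euclidsLemma)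
import Data.Nat.Properties as ℕₚ
open import Data.Product.Base using (∃-syntax; _,_)
open import Data.Sum.Base using (_⊎_; inj₁; inj₂; fromInj₂)
open import Data.Vec.Base as Vec using ([]; _∷_)
open import Data.Vec.Functional using (removeAt) renaming (_∷_ to infixr 5 _◂_)
open import Function.Base using (_∘_)
open import Relation.Binary.PropositionalEquality
open import Relation.Nullary.Decidable.Core using (yes; no)
open import Relation.Nullary.Negation.Core using (contradiction)
open import Algebra.Properties.Semiring.Sum +-*-semiring
  using (sum; sum-syntax; sum-cong-≗; sum-remove; ∑-comm; ∑-distrib-+; *-distribˡ-sum;
    *-distribʳ-sum)

private
  variable
    k m n : ℕ
    w x y z : ℤ

-- Congruences

-- _≡_[mod_] unfolds to a divisibility of a difference, from which its two sides
-- cannot be inferred; the record makes them inferable.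
infix 4 _≈_[mod_]

record _≈_[mod_] (x y : ℤ) (k : ℕ) : Set where
  constructor congruent
  field
    difference : x ≡ y [mod k ]

≡⇒≈ : x ≡ y → x ≈ y [mod k ]
≡⇒≈ {x} {k = k} refl = congruent (subst (+ k ∣_) (eq x (+ k)) (∣n⇒∣m*n 0ℤ ∣-refl))
  where
  eq : ∀ x k → 0ℤ * k ≡ x - x
  eq = solve-∀

≈-sym : x ≈ y [mod k ] → y ≈ x [mod k ]
≈-sym {x} {y} {k} (congruent p) = congruent (subst (+ k ∣_) (eq x y) (∣m⇒∣-m p))
  where
  eq : ∀ x y → - (x - y) ≡ y - x
  eq = solve-∀

≈-trans : x ≈ y [mod k ] → y ≈ z [mod k ] → x ≈ z [mod k ]
≈-trans {x} {y} {k} {z} (congruent p) (congruent q) =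
  congruent (subst (+ k ∣_) (eq x y z) (∣m∣n⇒∣m+n p q))
  where
  eq : ∀ x y z → (x - y) + (y - z) ≡ x - z
  eq = solve-∀

+-cong-mod : w ≈ x [mod k ] → y ≈ z [mod k ] → w + y ≈ x + z [mod k ]
+-cong-mod {w} {x} {k} {y} {z} (congruent p) (congruent q) =
  congruent (subst (+ k ∣_) (eq w x y z) (∣m∣n⇒∣m+n p q))
  where
  eq : ∀ w x y z → (w - x) + (y - z) ≡ (w + y) - (x + z)
  eq = solve-∀

*-congˡ-mod : ∀ x → y ≈ z [mod k ] → x * y ≈ x * z [mod k ]
*-congˡ-mod {y} {z} {k} x (congruent p) = congruent (subst (+ k ∣_) (eq x y z) (∣n⇒∣m*n x p))
  where
  eq : ∀ x y z → x * (y - z) ≡ x * y - x * z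
  eq = solve-∀

*-congʳ-mod : ∀ x → y ≈ z [mod k ] → y * x ≈ z * x [mod k ]
*-congʳ-mod {y} {z} {k} x p =
  subst₂ (_≈_[mod k ]) (*-comm x y) (*-comm x z) (*-congˡ-mod x p)

∣-resp-≈ : x ≈ y [mod k ] → + k ∣ x → + k ∣ y
∣-resp-≈ {x} {y} {k} (congruent p) k∣x = subst (+ k ∣_) (eq x y) (∣m∣n⇒∣m-n k∣x p)
  where
  eq : ∀ x y → x - (x - y) ≡ y
  eq = solve-∀

sum-cong-mod : {f g : Fin n → ℤ} → (∀ i → f i ≈ g i [mod k ]) → sum f ≈ sum g [mod k ]
sum-cong-mod {n = ℕ.zero}  f≈g = ≡⇒≈ refl
sum-cong-mod {n = ℕ.suc n} f≈g = +-cong-mod (f≈g zero) (sum-cong-mod (f≈g ∘ suc))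

sum-const-mod : {f : Fin n → ℤ} → (∀ i → f i ≈ x [mod k ]) → sum f ≈ + n * x [mod k ]
sum-const-mod {n = ℕ.zero}  {x = x} f≈x = ≡⇒≈ refl
sum-const-mod {n = ℕ.suc n} {x = x} f≈x =
  ≈-trans (+-cong-mod (f≈x zero) (sum-const-mod (f≈x ∘ suc))) (≡⇒≈ (eq (+ n) x))
  where
  eq : ∀ n x → x + n * x ≡ (1ℤ + n) * x
  eq = solve-∀

∣-sum : {f : Fin n → ℤ} → (∀ i → + k ∣ f i) → + k ∣ sum f
∣-sum {n = ℕ.zero}  k∣f = ∣n⇒∣m*n 0ℤ ∣-refl
∣-sum {n = ℕ.suc n} k∣f = ∣m∣n⇒∣m+n (k∣f zero) (∣-sum (k∣f ∘ suc))

%ℕ-injective-mod : .{{_ : ℕ.NonZero k}} → x %ℕ k ≡ y %ℕ k → x ≡ y [mod k ]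
%ℕ-injective-mod {k} {x} {y} eq = subst (+ k ∣_) x-y≡ (∣n⇒∣m*n (x /ℕ k - y /ℕ k) ∣-refl)
  where
  open ≡-Reasoning
  factor : ∀ r q q′ k → (q - q′) * k ≡ (r + q * k) - (r + q′ * k)
  factor = solve-∀
  x-y≡ : (x /ℕ k - y /ℕ k) * + k ≡ x - y
  x-y≡ = begin
    (x /ℕ k - y /ℕ k) * + k
      ≡⟨ factor (+ (x %ℕ k)) (x /ℕ k) (y /ℕ k) (+ k) ⟩
    (+ (x %ℕ k) + x /ℕ k * + k) - (+ (x %ℕ k) + y /ℕ k * + k)
      ≡⟨ cong (λ r → (+ (x %ℕ k) + x /ℕ k * + k) - (+ r + y /ℕ k * + k)) eq ⟩
    (+ (x %ℕ k) + x /ℕ k * + k) - (+ (y %ℕ k) + y /ℕ k * + k)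
      ≡⟨ cong₂ _-_ (a≡a%ℕn+[a/ℕn]*n x k) (a≡a%ℕn+[a/ℕn]*n y k) ⟨
    x - y ∎

-- The absolute difference of two naturals is at most their maximum, here below `k`, and a positive
-- number below `k` is not divisible by `k`.
toℕ-injective-mod : (i j : Fin k) → + toℕ i ≡ + toℕ j [mod k ] → i ≡ j
toℕ-injective-mod {k} i j i≡j with ℤ.∣ + toℕ i - + toℕ j ∣ in eq
... | ℕ.zero  = toℕ-injective (+-injective (i-j≡0⇒i≡j _ _ (∣i∣≡0⇒i≡0 eq)))
... | ℕ.suc r = contradiction (subst (k ℕ∣.∣_) eq (∣⇒∣ᵤ i≡j)) (>⇒∤ 1+r<k)
  where
  1+r<k : ℕ.suc r ℕ.< k
  1+r<k = ℕₚ.≤-<-trans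
    (subst (ℕ._≤ toℕ i ℕ.⊔ toℕ j) (trans (cong ℤ.∣_∣ (sym (m-n≡m⊖n (toℕ i) (toℕ j)))) eq)
      (∣m⊝n∣≤m⊔n (toℕ i) (toℕ j)))
    (ℕₚ.⊔-pres-<m (toℕ<n i) (toℕ<n j))

prime∣* : Prime k → + k ∣ x * y → (+ k ∣ x) ⊎ (+ k ∣ y)
prime∣* {k} {x} {y} pr k∣xy
  with euclidsLemma _ _ pr (subst (k ℕ∣.∣_) (abs-* x y) (∣⇒∣ᵤ k∣xy))
... | inj₁ k∣x = inj₁ (∣ᵤ⇒∣ k∣x)
... | inj₂ k∣y = inj₂ (∣ᵤ⇒∣ k∣y)

prime-cancelˡ : Prime k → ¬ (+ k ∣ x) → + k ∣ x * y → + k ∣ y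
prime-cancelˡ pr k∤x = fromInj₂ (λ k∣x → contradiction k∣x k∤x) ∘ prime∣* pr

-- Indicator vectors

χ : Subset n → Fin n → ℤ
χ A j = if Vec.lookup A j then 1ℤ else 0ℤ

∣∩∣≡∑χ : (A B : Subset n) → + ∣ A ∩ B ∣ ≡ ∑[ j < n ] (χ A j * χ B j)
∣∩∣≡∑χ []          []          = refl
∣∩∣≡∑χ (true ∷ A)  (true ∷ B)  = cong ℤ.suc (∣∩∣≡∑χ A B)
∣∩∣≡∑χ (true ∷ A)  (false ∷ B) = trans (∣∩∣≡∑χ A B) (sym (+-identityˡ _))
∣∩∣≡∑χ (false ∷ A) (true ∷ B)  = trans (∣∩∣≡∑χ A B) (sym (+-identityˡ _))
∣∩∣≡∑χ (false ∷ A) (false ∷ B) = trans (∣∩∣≡∑χ A B) (sym (+-identityˡ _))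

-- Exchanging the sums over sets and points exhibits the left side as the pairing of 1_B with the
-- vector ∑ eᵢ 1_{Vᵢ}. A combination that vanishes in every coordinate therefore pairs to zero with
-- every `B`.
∑∣∩∣≡∑∑χ : (e : Fin m → ℤ) (V : Fin m → Subset n) (B : Subset n) →
           ∑[ i < m ] (e i * + ∣ B ∩ V i ∣) ≡ ∑[ j < n ] (χ B j * ∑[ i < m ] (e i * χ (V i) j))
∑∣∩∣≡∑∑χ {m} {n} e V B = begin
  ∑[ i < m ] (e i * + ∣ B ∩ V i ∣)
    ≡⟨ sum-cong-≗ (λ i → trans (cong (e i *_) (∣∩∣≡∑χ B (V i))) (*-distribˡ-sum (e i) (λ j → χ B j * χ (V i) j))) ⟩
  ∑[ i < m ] ∑[ j < n ] (e i * (χ B j * χ (V i) j))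
    ≡⟨ ∑-comm (λ i j → e i * (χ B j * χ (V i) j)) ⟩
  ∑[ j < n ] ∑[ i < m ] (e i * (χ B j * χ (V i) j))
    ≡⟨ sum-cong-≗ (λ j → trans (sum-cong-≗ (λ i → swap (e i) (χ B j) (χ (V i) j)))
         (sym (*-distribˡ-sum (χ B j) (λ i → e i * χ (V i) j)))) ⟩
  ∑[ j < n ] (χ B j * ∑[ i < m ] (e i * χ (V i) j)) ∎
  where
  open ≡-Reasoning
  swap : ∀ x y z → x * (y * z) ≡ y * (x * z)
  swap = solve-∀

-- Linear dependence by pigeonhole

funToFin-cong : {f g : Fin m → Fin n} → f ≗ g → funToFin f ≡ funToFin g
funToFin-cong {m = ℕ.zero}  f≗g = refl
funToFin-cong {m = ℕ.suc m} f≗g = cong₂ combine (f≗g zero) (funToFin-cong (f≗g ∘ suc))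

-- There are k^m arguments and only k^n < k^m values, both coded as elements of `Fin`. Functions are
-- compared pointwise, and the codes translate this into equality.
pigeonhole-→ : 1 ℕ.< k → n ℕ.< m → (φ : (Fin m → Fin k) → Fin n → Fin k) →
               ∃[ c ] ∃[ c′ ] (¬ (c ≗ c′) × φ c ≗ φ c′)
pigeonhole-→ {k} {n} {m} 1<k n<m φ
  with pigeonhole (ℕₚ.^-monoʳ-< k 1<k n<m) (λ i → funToFin (φ (finToFun {k} {m} i)))
... | i , j , i<j , eq = finToFun i , finToFun j , c≢c′ , φc≗φc′
  where
  c≢c′ : ¬ (finToFun i ≗ finToFun j)
  c≢c′ c≗c′ = <⇒≢ i<j (trans (sym (funToFin-finToFin {m} {k} i))
    (trans (funToFin-cong c≗c′) (funToFin-finToFin {m} {k} j)))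
  φc≗φc′ : φ (finToFun i) ≗ φ (finToFun j)
  φc≗φc′ l = trans (sym (finToFun-funToFin (φ (finToFun i)) l))
    (trans (cong (λ t → finToFun t l) eq) (finToFun-funToFin (φ (finToFun j)) l))

-- Two different coefficient vectors with entries below `k` yield the same combination mod `k`, and
-- `e` is their difference. Its vanishing is expressed by pairings with all subsets `B`, since
-- `gram-nonsingular` uses it for the full set, the sets of the town and a singleton.
dependence-mod : .{{_ : ℕ.NonZero k}} → 1 ℕ.< k → n ℕ.< m → (V : Fin m → Subset n) →
  ∃[ e ] (¬ (∀ i → + k ∣ e i) × (∀ B → + k ∣ ∑[ i < m ] (e i * + ∣ B ∩ V i ∣)))
dependence-mod {k} {n} {m} 1<k n<m V = result (pigeonhole-→ 1<k n<m residues)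
  where
  combination : (Fin m → ℤ) → Fin n → ℤ
  combination e j = ∑[ i < m ] (e i * χ (V i) j)
  residues : (Fin m → Fin k) → Fin n → Fin k
  residues c j = fromℕ< (n%ℕd<d (combination (+_ ∘ toℕ ∘ c) j) k)
  split : ∀ x y z → (x - y) * z + y * z ≡ x * z
  split = solve-∀
  cancel : ∀ x y → (x + y) - y ≡ x
  cancel = solve-∀
  result : ∃[ c ] ∃[ c′ ] (¬ (c ≗ c′) × residues c ≗ residues c′) →
    ∃[ e ] (¬ (∀ i → + k ∣ e i) × (∀ B → + k ∣ ∑[ i < m ] (e i * + ∣ B ∩ V i ∣)))
  result (c , c′ , c≢c′ , same) = e , nontrivial , orthogonal
    where
    e₁ e₂ e : Fin m → ℤ
    e₁ = +_ ∘ toℕ ∘ c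
    e₂ = +_ ∘ toℕ ∘ c′
    e i = e₁ i - e₂ i
    nontrivial : ¬ (∀ i → + k ∣ e i)
    nontrivial k∣e = c≢c′ (λ i → toℕ-injective-mod (c i) (c′ i) (k∣e i))
    combination-diff : ∀ j → combination e₁ j - combination e₂ j ≡ combination e j
    combination-diff j = begin
      combination e₁ j - combination e₂ j
        ≡⟨ cong (_- combination e₂ j) (sum-cong-≗ (λ i → split (e₁ i) (e₂ i) (χ (V i) j))) ⟨
      ∑[ i < m ] (e i * χ (V i) j + e₂ i * χ (V i) j) - combination e₂ j
        ≡⟨ cong (_- combination e₂ j) (∑-distrib-+ (λ i → e i * χ (V i) j) _) ⟩
      (combination e j + combination e₂ j) - combination e₂ j
        ≡⟨ cancel (combination e j) (combination e₂ j) ⟩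
      combination e j ∎
      where open ≡-Reasoning
    vanishes : ∀ j → + k ∣ combination e j
    vanishes j = subst (+ k ∣_) (combination-diff j)
      (%ℕ-injective-mod {x = combination e₁ j} (fromℕ<-injective _ _ _ _ (same j)))
    orthogonal : ∀ B → + k ∣ ∑[ i < m ] (e i * + ∣ B ∩ V i ∣)
    orthogonal B = subst (+ k ∣_) (sym (∑∣∩∣≡∑∑χ e V B))
      (∣-sum (λ j → ∣n⇒∣m*n (χ B j) (vanishes j)))

-- Towns

lookup-injective : ∀ {A : Set} {xs : List A} → Unique xs → ∀ i j → lookup xs i ≡ lookup xs j → i ≡ j
lookup-injective (x∉ ∷ u) zero    zero    eq = refl
lookup-injective (x∉ ∷ u) zero    (suc j) eq = contradiction eq (All.lookup x∉ (∈-lookup j))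
lookup-injective (x∉ ∷ u) (suc i) zero    eq = contradiction (sym eq) (All.lookup x∉ (∈-lookup i))
lookup-injective (x∉ ∷ u) (suc i) (suc j) eq = cong suc (lookup-injective u i j eq)

-- The two premises are n (d + a u) = 0 and a d + (b n + a - b) u = 0 with n
-- replaced by its residue ν, in the shape in which the pairings produce them.
Nondegenerate : ℕ → ℤ → ℤ → ℤ → Set
Nondegenerate p a b ν = ∀ d u →
  + p ∣ d * ν + (ν * u) * a → + p ∣ d * a + (u * a + (ν * u - u) * b) → + p ∣ u

module _ {p : ℕ} {a b ν : ℤ} (pr : Prime p) (p∤a-b : ¬ (+ p ∣ a - b)) where

  -- Writing the size of the ground set as a successor provides a reference coefficient `c zero` and
  -- a point for the singleton used at the end.
  gram-nonsingular : Nondegenerate p a b ν → + ℕ.suc n ≈ ν [mod p ] →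
    (A : Fin (ℕ.suc n) → Subset (ℕ.suc n)) →
    (∀ i → + ∣ A i ∣ ≈ a [mod p ]) → (∀ i j → i ≢ j → + ∣ A i ∩ A j ∣ ≈ b [mod p ]) →
    (e : Fin (ℕ.suc (ℕ.suc n)) → ℤ) →
    (∀ B → + p ∣ sum (λ i → e i * + ∣ B ∩ (⊤ ◂ A) i ∣)) → ∀ i → + p ∣ e i
  gram-nonsingular {n} nondeg n≈ν A sizes inters e dep = λ { zero → p∣d ; (suc i) → p∣c i }
    where
    d u S : ℤ
    d = e zero
    c : Fin (ℕ.suc n) → ℤ
    c = e ∘ suc
    u = c zero
    S = sum c
    R : Fin (ℕ.suc n) → ℤ
    R i = sum (removeAt c i)

    pair-⊤ : + p ∣ d * ν + S * a
    pair-⊤ = ∣-resp-≈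
      (+-cong-mod
        (*-congˡ-mod d (≈-trans
          (≡⇒≈ (cong +_ (trans (cong ∣_∣ (∩-identityˡ (⊤ {ℕ.suc n}))) (∣⊤∣≡n (ℕ.suc n))))) n≈ν))
        (≈-trans
          (sum-cong-mod (λ i → *-congˡ-mod (c i)
            (≈-trans (≡⇒≈ (cong (+_ ∘ ∣_∣) (∩-identityˡ (A i)))) (sizes i))))
          (≡⇒≈ (sym (*-distribʳ-sum a c)))))
      (dep ⊤)

    -- The diagonal term `j = i` contributes `c i * a`. Every other intersection has size congruent
    -- to `b`, and the remaining coefficients sum to `R i`.
    pair-A : ∀ i → + p ∣ d * a + (c i * a + R i * b)
    pair-A i = ∣-resp-≈
      (+-cong-mod
        (*-congˡ-mod d (≈-trans (≡⇒≈ (cong (+_ ∘ ∣_∣) (∩-identityʳ (A i)))) (sizes i)))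
        (≈-trans
          (≡⇒≈ (sum-remove {i = i} (λ j → c j * + ∣ A i ∩ A j ∣)))
          (+-cong-mod
            (*-congˡ-mod (c i) (≈-trans (≡⇒≈ (cong (+_ ∘ ∣_∣) (∩-idem (A i)))) (sizes i)))
            (≈-trans
              (sum-cong-mod (λ j → *-congˡ-mod (c (punchIn i j))
                (inters i (punchIn i j) (≢-sym (punchInᵢ≢i i j)))))
              (≡⇒≈ (sym (*-distribʳ-sum b (removeAt c i))))))))
      (dep (A i))

    R≡S-c : ∀ i → R i ≡ S - c i
    R≡S-c i = trans (eq (c i) (R i)) (cong (_- c i) (sym (sum-remove {i = i} c)))
      where
      eq : ∀ x y → y ≡ (x + y) - x
      eq = solve-∀

    -- In the difference of the pairings with `A i` and `A zero`, both `d` and `S` cancel.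
    c≈u : ∀ i → c i ≈ u [mod p ]
    c≈u i = congruent (prime-cancelˡ pr p∤a-b (subst (+ p ∣_)
      (trans (cong₂ (λ r r₀ → (d * a + (c i * a + r * b)) - (d * a + (u * a + r₀ * b)))
               (R≡S-c i) (R≡S-c zero))
             (eq a b d S (c i) u))
      (∣m∣n⇒∣m-n (pair-A i) (pair-A zero))))
      where
      eq : ∀ a b d S x u → (d * a + (x * a + (S - x) * b)) - (d * a + (u * a + (S - u) * b))
                           ≡ (a - b) * (x - u)
      eq = solve-∀

    -- There are as many sets as points, so the number of summands is also congruent to `ν`.
    S≈νu : S ≈ ν * u [mod p ]
    S≈νu = ≈-trans (sum-const-mod c≈u) (*-congʳ-mod u n≈ν)

    p∣u : + p ∣ u
    p∣u = nondeg d u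
      (∣-resp-≈ (+-cong-mod (≡⇒≈ {d * ν} refl) (*-congʳ-mod a S≈νu)) pair-⊤)
      (∣-resp-≈
        (+-cong-mod (≡⇒≈ {d * a} refl) (+-cong-mod (≡⇒≈ {u * a} refl) (*-congʳ-mod b
          (≈-trans (≡⇒≈ (R≡S-c zero)) (+-cong-mod S≈νu (≡⇒≈ { - u} refl))))))
        (pair-A zero))

    p∣c : ∀ i → + p ∣ c i
    p∣c i = ∣-resp-≈ (≈-sym (c≈u i)) p∣u

    -- The pairings with `⊤` and the `A i` say nothing about `d` when `a` and `ν` both vanish mod
    -- `p`. Pairing with a singleton reads off one coordinate, where only `d` is left once all `c i`
    -- vanish.
    p∣d : + p ∣ d
    p∣d = subst (+ p ∣_)
      (trans (cong (λ s → d * + s)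
               (trans (cong ∣_∣ (∩-identityʳ ⁅ zero {n} ⁆)) (∣⁅x⁆∣≡1 (zero {n}))))
             (*-identityʳ d))
      (∣m+n∣n⇒∣m (dep ⁅ zero ⁆) (∣-sum (λ i → ∣m⇒∣m*n (+ ∣ ⁅ zero ⁆ ∩ A i ∣) (p∣c i))))

  -- With more than `n` members, the first n + 1 of them and the full set give n + 2 vectors in
  -- dimension n + 1. Their nontrivial dependence contradicts `gram-nonsingular`.
  town-size≤ : 1 ℕ.< p → Nondegenerate p a b ν → + ℕ.suc n ≈ ν [mod p ] →
    (F : Family (ℕ.suc n)) → IsTown p a b F → size F ℕ.≤ n
  town-size≤ {n} 1<p nondeg n≈ν F town = ℕₚ.≮⇒≥ λ n<size →
    let
      index i = inject≤ i n<size
      A i = lookup (members F) (index i)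
      A-injective i j eq = inject≤-injective n<size n<size i j
        (lookup-injective (unique F) (index i) (index j) eq)
      e , nontrivial , dep = dependence-mod 1<p ℕₚ.≤-refl (⊤ ◂ A)
    in nontrivial (gram-nonsingular nondeg n≈ν A
      (λ i → congruent (sizes (∈-lookup (index i))))
      (λ i j i≢j → congruent
        (intersections (∈-lookup (index i)) (∈-lookup (index j)) (i≢j ∘ A-injective i j)))
      e dep)
    where
    open IsTown town
    instance
      p≢0 : ℕ.NonZero p
      p≢0 = ℕ.>-nonZero (ℕₚ.<-trans ℕₚ.0<1+n 1<p)

-- For ν nonzero mod `p`, eliminating d works as soon as a² - a + b - bν is nonzero. At ν = 1 this
-- is a(a - 1), so only a ≡ 0 and a ≡ 1 call for another residue. Here `b` is a natural number
-- because it may itself be that residue.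
nondegenerate-residue : ∀ {p a} b → Prime p → ¬ (+ p ∣ + b) → ¬ (+ p ∣ a - + b) →
                        ∃[ r ] Nondegenerate p a (+ b) (+ r)
nondegenerate-residue {p} {a} b pr p∤b p∤a-b with + p ∣? a | + p ∣? a - 1ℤ
... | yes p∣a | _ = 0 , λ d u _ p∣f →
  prime-cancelˡ pr p∤a-b (subst (+ p ∣_) (eq a (+ b) d u) (∣m∣n⇒∣m-n p∣f (∣m⇒∣m*n d p∣a)))
  where
  eq : ∀ a b d u → (d * a + (u * a + (0ℤ * u - u) * b)) - a * d ≡ (a - b) * u
  eq = solve-∀
-- Subtracting the second premise from a(d + au) leaves (a - b)(a + b - 1)u, whose factor a + b - 1
-- is b modulo a - 1.
... | no p∤a | yes p∣a-1 = b , λ d u p∣f p∣g →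
  let p∣d+au = prime-cancelˡ pr p∤b (subst (+ p ∣_) (factor a (+ b) d u) p∣f) in
  prime-cancelˡ pr p∤a-b (prime-cancelˡ pr p∤b (subst (+ p ∣_) (eq a (+ b) d u)
    (∣m∣n⇒∣m+n (∣m∣n⇒∣m-n (∣n⇒∣m*n a p∣d+au) p∣g) (∣n⇒∣m*n (u * (+ b - a)) p∣a-1))))
  where
  factor : ∀ a b d u → d * b + (b * u) * a ≡ b * (d + a * u)
  factor = solve-∀
  eq : ∀ a b d u →
    (a * (d + a * u) - (d * a + (u * a + (b * u - u) * b))) + (u * (b - a)) * (a - 1ℤ)
    ≡ b * ((a - b) * u)
  eq = solve-∀
-- At ν = 1 the coefficient of b in the second premise vanishes.
... | no p∤a | no p∤a-1 = 1 , λ d u p∣f p∣g →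
  prime-cancelˡ pr p∤a-1 (prime-cancelˡ pr p∤a (subst (+ p ∣_) (eq a (+ b) d u)
    (∣m∣n⇒∣m-n (∣n⇒∣m*n a p∣f) p∣g)))
  where
  eq : ∀ a b d u →
    a * (d * 1ℤ + (1ℤ * u) * a) - (d * a + (u * a + (1ℤ * u - u) * b)) ≡ a * ((a - 1ℤ) * u)
  eq = solve-∀

unbounded-residue-class : ∀ p r N → ∃[ n ] (N ℕ.≤ n × + ℕ.suc n ≡ + r [mod ℕ.suc p ])
unbounded-residue-class p r N = l , N≤l , subst (+ ℕ.suc p ∣_) eq (∣n⇒∣m*n (+ ℕ.suc N) ∣-refl)
  where
  l : ℕ
  -- With this choice `ℕ.suc l` unfolds to (N + 1)(p + 1) + r, which lies N + 1 periods above `r`;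
  -- `eq` relies on the unfolding.
  l = p ℕ.+ N ℕ.* ℕ.suc p ℕ.+ r
  N≤l : N ℕ.≤ l
  N≤l = ℕₚ.≤-trans (ℕₚ.m≤m*n N (ℕ.suc p))
    (ℕₚ.≤-trans (ℕₚ.m≤n+m (N ℕ.* ℕ.suc p) p) (ℕₚ.m≤m+n _ r))
  cancel : ∀ x y → x ≡ (x + y) - y
  cancel = solve-∀
  eq : + ℕ.suc N * + ℕ.suc p ≡ + ℕ.suc l - + r
  eq = cancel (+ (ℕ.suc N ℕ.* ℕ.suc p)) (+ r)

theorem1p5 : (p : ℕ) → Prime p → (a b : ℤ) →
    0ℤ ≤ a → a ≤ + p - 1ℤ → 0ℤ ≤ b → b ≤ + p - 1ℤ →
    ¬ (+ p ∣ b) → ¬ (+ p ∣ a - b) →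
    InfinitelyMany (λ n → (0 ℕ.< n) × ((F : Family n) → IsTown p a b F → size F ℕ.≤ n ∸ 1))
theorem1p5 ℕ.zero      pr = contradiction pr ¬prime[0]
-- The bound 0 ≤ b rules out the negative constructor, so `b` is available as a residue.
theorem1p5 (ℕ.suc p-1) pr a (+ b) _ _ _ _ p∤b p∤a-b N =
  let r , nondeg     = nondegenerate-residue b pr p∤b p∤a-b
      n , N≤n , n≡r = unbounded-residue-class p-1 r N
  in ℕ.suc n , ℕ.s≤s N≤n , ℕ.s≤s ℕ.z≤n ,
     town-size≤ pr p∤a-b (ℕ.nonTrivial⇒n>1 _ {{prime⇒nonTrivial pr}}) nondeg (congruent n≡r)
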